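{- Let $K\subsetneq L$ be a field extension, and let $A,B\subseteq L$ be $n$-dimensional $K$-subspaces with $0 < n < \infty$ and $1\notin B$. For a basis $\mathcal{A}=\{a_1,\dots,a_n\}$ of $A$ and for $i\in [n]$, define the $K$-subspace $$T_i(\mathcal{A}) = a_i^{ -1}A\cap B \subseteq B.$$ Define $$\Omega(\mathcal{A}) = \max_{J\subseteq [n]}\Bigl(|J|+\dim \bigcap_{i\in J}T_i(\mathcal{A}) - n\Bigr),$$ where the intersection is understood to equal $B$ when $J = \emptyset$. Then: (i) $\Omega(\mathcal{A})$ equals the least integer $d\ge 0$ for which there exists a basis $\mathcal{B}=\{b_1,\dots,b_n\}$ of $B$ such that $\mathcal{A}$ is partially matched to $\mathcal{B}$ with defect $d$. (ii) Consequently, $$\delta(A,B)=\max_{\mathcal{A}} \Omega(\mathcal{A}),$$ where $\mathcal{A}$ runs over all ordered bases of $A$.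
   Context: Fields are commutative. All dimensions are over $K$. $[n]=\{1,\dots,n\}$, and $\langle X\rangle$ denotes the $K$-span of a set $X$. Definition (partial matching of bases). Let $A,B$ be $n$-dimensional $K$-subspaces of $L$, $n\ge 1$, and $0\le d\le n$ an integer. An ordered basis $\mathcal{A}=\{a_1,\dots,a_n\}$ of $A$ is partially matched to an ordered basis $\mathcal{B}=\{b_1,\dots,b_n\}$ of $B$ with defect $d$ if there exists $P\subseteq[n]$ with $|P|=n-d$ such that $$a_i^{ -1}A\cap B\subseteq \langle b_1,\dots,b_{i-1},b_{i+1},\dots,b_n\rangle\quad\text{for each } i\in P.$$ Definition (partial matching of subspaces). $A$ is partially matched to $B$ with defect $d$ if for every ordered basis $\mathcal{A}$ of $A$ there exists an ordered basis $\mathcal{B}$ of $B$ such that $\mathcal{A}$ is partially matched to $\mathcal{B}$ with defect $d$. Definition (deficiency). For $n$-dimensional $A,B$ with $0<n<\infty$ and $1\notin B$, $\delta(A,B)$ is the least nonnegative integer $d$ for which $A$ is partially matched to $B$ with defect $d$. -}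

module Defs where

open import Level using (Level; _⊔_; suc)
open import Algebra.Bundles using (CommutativeRing)
open import Algebra.Definitions using (Invertible)
open import Algebra.Morphism.Structures using (IsRingMonomorphism)
open import Data.Bool.Base using (if_then_else_)
open import Data.Fin.Base using (Fin)
open import Data.Fin.Properties using (_≟_)
open import Data.Fin.Subset as Subset using (Subset; ∣_∣)
open import Data.Integer.Base as ℤ using (ℤ; +_)
open import Data.Nat.Base as ℕ using (ℕ; _∸_)
open import Data.Product.Base using (∃; ∃-syntax; _×_; _,_; proj₁)
open import Data.Vec.Functional using (Vector; replicate)
open import Relation.Binary.Definitions using (_Respects_)
open import Relation.Binary.PropositionalEquality.Core as ≡ using (_≡_; _≢_)
open import Relation.Nullary using (¬_; does; yes; no; contradiction)
open import Relation.Unary using (Pred; _∈_; _⊆_)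
import Algebra.Properties.CommutativeMonoid.Sum as Sum
import Algebra.Properties.CommutativeSemigroup as CommutativeSemigroupProperties

IsLeast : ∀ {ℓ} → Pred ℕ ℓ → ℕ → Set ℓ
IsLeast P d = P d × (∀ e → P e → d ℕ.≤ e)

IsMaximum : ∀ {ℓ} → Pred ℤ ℓ → ℤ → Set ℓ
IsMaximum P m = P m × (∀ z → P z → z ℤ.≤ m)

-- Classical fields.  The library's HeytingField carries an apartness relation
-- as extra data; here "nonzero" is just the negation of "equal to zero".

record Field c ℓ : Set (suc (c ⊔ ℓ)) where
  field
    commutativeRing : CommutativeRing c ℓ

  open CommutativeRing commutativeRing public

  field
    0≉1        : 0# ≉ 1#
    invertible : ∀ {x} → x ≉ 0# → Invertible _≈_ 1# _*_ x

  _⁻¹[_] : ∀ x → x ≉ 0# → Carrier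
  x ⁻¹[ x≉0 ] = proj₁ (invertible x≉0)

record FieldExtension k ℓk c ℓ : Set (suc (k ⊔ ℓk ⊔ c ⊔ ℓ)) where
  field
    K : Field k ℓk
    L : Field c ℓ

  module K = Field K
  module L = Field L

  field
    ι                  : K.Carrier → L.Carrier
    isRingMonomorphism : IsRingMonomorphism K.rawRing L.rawRing ι

  module ι = IsRingMonomorphism isRingMonomorphism

  IsProper : Set (k ⊔ c ⊔ ℓ)
  IsProper = ∃[ x ] (∀ a → ¬ (ι a L.≈ x))

module LinearAlgebra {k ℓk c ℓ : Level} (E : FieldExtension k ℓk c ℓ) where

  open FieldExtension E using (K; L; ι; module K; module L; module ι)
  open L using (_≈_; _≉_; _+_; _*_; 0#; 1#; _⁻¹[_])
  open Sum L.+-commutativeMonoid using (sum; sum-cong-≋; sum-replicate-zero)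
  open CommutativeSemigroupProperties L.*-commutativeSemigroup using (x∙yz≈y∙xz)

  record Subspace p : Set (k ⊔ c ⊔ ℓ ⊔ suc p) where
    field
      ⟦_⟧      : Pred L.Carrier p
      respects : ⟦_⟧ Respects _≈_
      0∈       : 0# ∈ ⟦_⟧
      +-closed : ∀ {x y} → x ∈ ⟦_⟧ → y ∈ ⟦_⟧ → x + y ∈ ⟦_⟧
      ·-closed : ∀ a {x} → x ∈ ⟦_⟧ → ι a * x ∈ ⟦_⟧

  open Subspace public using (⟦_⟧)

  linearCombination : ∀ {n} → Vector K.Carrier n → Vector L.Carrier n → L.Carrier
  linearCombination a v = sum (λ i → ι (a i) * v i)

  ⟨_⟩ : ∀ {p} → Pred L.Carrier p → Pred L.Carrier (k ⊔ c ⊔ ℓ ⊔ p)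
  ⟨ X ⟩ x = ∃[ m ] ∃[ a ] ∃[ v ] (∀ (i : Fin m) → v i ∈ X) × x ≈ linearCombination a v

  LinearlyIndependent : ∀ {n} → Vector L.Carrier n → Set (k ⊔ ℓk ⊔ ℓ)
  LinearlyIndependent v =
    ∀ a → linearCombination a v ≈ 0# → ∀ i → a i K.≈ K.0#

  record OrderedBasis {p} (S : Subspace p) (n : ℕ) : Set (k ⊔ ℓk ⊔ c ⊔ ℓ ⊔ p) where
    field
      vec         : Vector L.Carrier n
      vec∈        : ∀ i → vec i ∈ ⟦ S ⟧
      independent : LinearlyIndependent vec
      spanning    : ⟦ S ⟧ ⊆ ⟨ (λ y → ∃[ i ] vec i ≈ y) ⟩

  open OrderedBasis public using (vec)

  HasDimension : ∀ {p} → Subspace p → ℕ → Set (k ⊔ ℓk ⊔ c ⊔ ℓ ⊔ p)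
  HasDimension S n = OrderedBasis S n

  vec≉0 : ∀ {p} {S : Subspace p} {n} (𝒜 : OrderedBasis S n) → ∀ i → vec 𝒜 i ≉ 0#
  vec≉0 {n = n} 𝒜 i vᵢ≈0 = K.0≉1 (K.sym (K.trans (K.sym δᵢᵢ≈1)
    (OrderedBasis.independent 𝒜 δᵢ
      (L.trans (sum-cong-≋ term≈0) (sum-replicate-zero n)) i)))
    where
    δᵢ : Vector K.Carrier n
    δᵢ j = if does (i ≟ j) then K.1# else K.0#

    δᵢᵢ≈1 : δᵢ i K.≈ K.1#
    δᵢᵢ≈1 with i ≟ i
    ... | yes _   = K.refl
    ... | no  i≢i = contradiction ≡.refl i≢i

    term≈0 : ∀ j → ι (δᵢ j) * vec 𝒜 j ≈ 0#
    term≈0 j with i ≟ j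
    ... | yes ≡.refl = L.trans (L.*-congˡ vᵢ≈0) (L.zeroʳ _)
    ... | no  _      = L.trans (L.*-congʳ ι.0#-homo) (L.zeroˡ _)

  _·_ : ∀ {p} → L.Carrier → Subspace p → Subspace (c ⊔ ℓ ⊔ p)
  z · S = record
    { ⟦_⟧      = λ x → ∃[ y ] y ∈ ⟦ S ⟧ × x ≈ z * y
    ; respects = λ x≈x′ (y , y∈S , x≈zy) → y , y∈S , L.trans (L.sym x≈x′) x≈zy
    ; 0∈       = 0# , S.0∈ , L.sym (L.zeroʳ z)
    ; +-closed = λ (y , y∈S , x≈zy) (y′ , y′∈S , x′≈zy′) →
        y + y′ , S.+-closed y∈S y′∈S ,
        L.trans (L.+-cong x≈zy x′≈zy′) (L.sym (L.distribˡ z y y′))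
    ; ·-closed = λ a (y , y∈S , x≈zy) →
        ι a * y , S.·-closed a y∈S ,
        L.trans (L.*-congˡ x≈zy) (x∙yz≈y∙xz (ι a) z y)
    }
    where module S = Subspace S

  _∩_ : ∀ {p q} → Subspace p → Subspace q → Subspace (p ⊔ q)
  S ∩ T = record
    { ⟦_⟧      = λ x → x ∈ ⟦ S ⟧ × x ∈ ⟦ T ⟧
    ; respects = λ x≈y (s , t) → S.respects x≈y s , T.respects x≈y t
    ; 0∈       = S.0∈ , T.0∈
    ; +-closed = λ (s , t) (s′ , t′) → S.+-closed s s′ , T.+-closed t t′
    ; ·-closed = λ a (s , t) → S.·-closed a s , T.·-closed a t
    }
    where
    module S = Subspace S
    module T = Subspace T

  -- The intersection of the T i (i ∈ J), taken inside B, so that the empty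
  -- intersection is B; when J is nonempty and every T i lies in B this is the
  -- plain intersection.
  ⋂-in : ∀ {p q n} → Subspace p → Subset n → (Fin n → Subspace q) → Subspace (p ⊔ q)
  ⋂-in B J T = record
    { ⟦_⟧      = λ x → x ∈ ⟦ B ⟧ × (∀ i → i Subset.∈ J → x ∈ ⟦ T i ⟧)
    ; respects = λ x≈y (b , t) → B.respects x≈y b , λ i i∈J → T.respects i x≈y (t i i∈J)
    ; 0∈       = B.0∈ , λ i _ → T.0∈ i
    ; +-closed = λ (b , t) (b′ , t′) →
        B.+-closed b b′ , λ i i∈J → T.+-closed i (t i i∈J) (t′ i i∈J)
    ; ·-closed = λ a (b , t) → B.·-closed a b , λ i i∈J → T.·-closed i a (t i i∈J)
    }
    where
    module B = Subspace B
    module T i = Subspace (T i)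

  module _ {p : Level} {A : Subspace p} {n : ℕ} where

    T : OrderedBasis A n → Subspace p → Fin n → Subspace (c ⊔ ℓ ⊔ p)
    T 𝒜 B i = ((vec 𝒜 i ⁻¹[ vec≉0 𝒜 i ]) · A) ∩ B

    BasisPartiallyMatched : {B : Subspace p} →
      OrderedBasis A n → OrderedBasis B n → ℕ → Set (k ⊔ c ⊔ ℓ ⊔ p)
    BasisPartiallyMatched {B} 𝒜 ℬ d =
      d ℕ.≤ n ×
      ∃[ P ] ∣ P ∣ ≡ n ∸ d ×
             (∀ i → i Subset.∈ P →
               ⟦ T 𝒜 B i ⟧ ⊆ ⟨ (λ y → ∃[ j ] j ≢ i × vec ℬ j ≈ y) ⟩)

    ΩCandidate : OrderedBasis A n → Subspace p → Pred ℤ (k ⊔ ℓk ⊔ c ⊔ ℓ ⊔ p)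
    ΩCandidate 𝒜 B z =
      ∃[ J ] ∃[ d ] HasDimension (⋂-in B J (T 𝒜 B)) d ×
                    z ≡ + ∣ J ∣ ℤ.+ + d ℤ.- + n

    -- "z = Ω(𝒜)".  Ω is a relation rather than a function because the
    -- dimension of an intersection is not computable from the data.
    IsΩ : OrderedBasis A n → Subspace p → ℤ → Set (k ⊔ ℓk ⊔ c ⊔ ℓ ⊔ p)
    IsΩ 𝒜 B = IsMaximum (ΩCandidate 𝒜 B)

  PartiallyMatched : ∀ {p} → Subspace p → Subspace p → ℕ → ℕ →
                     Set (k ⊔ ℓk ⊔ c ⊔ ℓ ⊔ p)
  PartiallyMatched A B n d =
    (𝒜 : OrderedBasis A n) → ∃[ ℬ ] BasisPartiallyMatched {B = B} 𝒜 ℬ d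

  -- "δ = δ(A,B)" for n-dimensional A and B.
  IsDeficiency : ∀ {p} → Subspace p → Subspace p → ℕ → ℕ →
                 Set (k ⊔ ℓk ⊔ c ⊔ ℓ ⊔ p)
  IsDeficiency A B n = IsLeast (PartiallyMatched A B n)

{-# OPTIONS --safe #-}
-- Write b for a basis of B and say that b avoids Tᵢ at i when Tᵢ ⊆ ⟨bⱼ : j ≢ i⟩.
-- If b avoids Tᵢ for i ∈ P, then ⋂_{J} Tᵢ ⊆ ⟨bₗ : l ∉ P ∩ J⟩, which bounds its
-- dimension by n - |P ∩ J| and gives Ω ≤ d.
--
-- For the converse take |P| maximal.  When i ∉ P and bₕ ∉ Tᵢ, swapping the labels
-- i and h and shearing the other vectors along bₕ into a hyperplane containing Tᵢ
-- yields a basis that avoids on (P ∖ {h}) ∪ {i}; so maximality forces h ∈ P.  Let J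
-- collect the indices missed by some P′ reachable through such exchanges.  The
-- exchanges only relabel the vectors bₗ with l ∉ P ∩ J, and every one of these lies
-- in Tᵢ as soon as i is missed, hence in all Tᵢ with i ∈ J.  So ⋂_{J} Tᵢ has
-- dimension n - |P ∩ J|, and since ∁P ⊆ J the pair attains |J| + dim - n = n - |P|.
module Submission where

open import Defs
open import Level using (Level; _⊔_; Lift; lift; lower)
open import Axiom.ExcludedMiddle using (ExcludedMiddle)
import Algebra.Properties.CommutativeSemigroup as CommutativeSemigroupProperties
import Algebra.Properties.Semiring.Sum as SemiringSum
import Algebra.Properties.CommutativeMonoid.Sum as Sum
import Algebra.Properties.Group as GroupProperties
open import Data.Fin.Base using (Fin; zero; suc; punchIn)
import Data.Fin.Permutation.Components as PC
open import Data.Fin.Permutation using (Permutation′; _⟨$⟩ʳ_; _⟨$⟩ˡ_; inverseˡ; inverseʳ; transpose)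
open import Data.Fin.Properties using (_≟_; any?)
open import Data.Fin.Subset as Subset using (Subset; inside; outside; ∣_∣; ∁)
open import Data.Fin.Subset.Properties using (∉⊥; ∣⊥∣≡0; ∣⊤∣≡n; ∣p∣≤n; ∣∁p∣≡n∸∣p∣; p⊆q⇒∣p∣≤∣q∣; x∈p∪q⁺; x∈p∩q⁺; x∈p∩q⁻; x∉∁p⇒x∈p; x∈∁p⇒x∉p; _∈?_)
open import Data.Integer.Base as ℤ using (+_)
import Data.Integer.Properties as ℤ
open import Data.Nat.Base as ℕ using (ℕ; _<_; _≤_; z≤n; s≤s; _∸_)
import Data.Nat.Properties as ℕ
open import Data.Product.Base using (∃-syntax; _×_; _,_; proj₁; proj₂)
open import Data.Sum.Base as ⊎ using (_⊎_; inj₁; inj₂)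
open import Data.Vec.Base using (Vec; []; _∷_; _[_]=_; here; there; _[_]≔_)
open import Data.Vec.Functional using (Vector; updateAt; insertAt; replicate)
open import Data.Vec.Functional.Properties using (updateAt-updates; updateAt-minimal; insertAt-lookup; insertAt-punchIn)
open import Data.Vec.Properties using ([]≔-updates; []=-injective)
open import Function.Base using (_∘_; const; case_of_)
open import Relation.Binary.Construct.Closure.ReflexiveTransitive using (Star; ε; _◅_; _◅◅_)
open import Relation.Binary.PropositionalEquality as ≡ using (_≡_; _≢_)
open import Relation.Nullary using (¬_; Dec; yes; no; contradiction; ¬?)
open import Relation.Nullary.Decidable using (map′; decidable-stable)
open import Relation.Unary using (Pred; _∈_; _∉_; _⊆_; ∅)

-- Excluded middle, least numbers and finite subsets

-- Excluded middle is assumed once, at a joint level; propositions at smaller levels are lifted to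
-- it.
lowerEM : ∀ a b → ExcludedMiddle (a ⊔ b) → ExcludedMiddle a
lowerEM a b em {P} = map′ lower lift (em {Lift b P})

least : ∀ {a} {Q : Pred ℕ a} → (∀ n → Dec (Q n)) → ∀ {d} → Q d → ∃[ e ] IsLeast Q e
least Q? {d} Qd with Q? 0
... | yes Q0 = 0 , Q0 , λ _ _ → z≤n
least Q? {ℕ.zero}  Qd | no ¬Q0 = contradiction Qd ¬Q0
least Q? {ℕ.suc d} Qd | no ¬Q0 with least (Q? ∘ ℕ.suc) Qd
... | e , Qe , e≤ = ℕ.suc e , Qe , λ { ℕ.zero Q0 → contradiction Q0 ¬Q0 ; (ℕ.suc f) Qf → s≤s (e≤ f Qf) }

comprehension : ∀ {a n} (Q : Pred (Fin n) a) → (∀ i → Dec (Q i)) →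
                ∃[ J ] ∀ i → (i Subset.∈ J → Q i) × (Q i → i Subset.∈ J)
comprehension {n = ℕ.zero}  Q Q? = [] , λ ()
comprehension {n = ℕ.suc n} Q Q? with Q? zero | comprehension (Q ∘ suc) (Q? ∘ suc)
... | yes Q0 | J , J⇔Q = inside ∷ J , λ
  { zero    → (λ _ → Q0) , λ _ → here
  ; (suc i) → (λ { (there i∈J) → proj₁ (J⇔Q i) i∈J }) , there ∘ proj₂ (J⇔Q i) }
... | no ¬Q0 | J , J⇔Q = outside ∷ J , λ
  { zero    → (λ ()) , λ Q0 → contradiction Q0 ¬Q0
  ; (suc i) → (λ { (there i∈J) → proj₁ (J⇔Q i) i∈J }) , there ∘ proj₂ (J⇔Q i) }

[]≔-minimal⁻ : ∀ {a} {A : Set a} {n} (xs : Vec A n) {i j x y} → i ≢ j → (xs [ j ]≔ y) [ i ]= x → xs [ i ]= x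
[]≔-minimal⁻ (x ∷ xs) {zero}  {zero}  i≢j _         = contradiction ≡.refl i≢j
[]≔-minimal⁻ (x ∷ xs) {zero}  {suc j} i≢j here      = here
[]≔-minimal⁻ (x ∷ xs) {suc i} {zero}  i≢j (there e) = there e
[]≔-minimal⁻ (x ∷ xs) {suc i} {suc j} i≢j (there e) = there ([]≔-minimal⁻ xs (i≢j ∘ ≡.cong suc) e)

∣insert∣ : ∀ {n} {p : Subset n} {x} → x Subset.∉ p → ∣ p [ x ]≔ inside ∣ ≡ ℕ.suc ∣ p ∣
∣insert∣ {p = inside  ∷ p} {zero}  x∉p = contradiction here x∉p
∣insert∣ {p = outside ∷ p} {zero}  x∉p = ≡.refl
∣insert∣ {p = inside  ∷ p} {suc x} x∉p = ≡.cong ℕ.suc (∣insert∣ (x∉p ∘ there))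
∣insert∣ {p = outside ∷ p} {suc x} x∉p = ∣insert∣ (x∉p ∘ there)

∣remove∣ : ∀ {n} {p : Subset n} {x} → x Subset.∈ p → ℕ.suc ∣ p [ x ]≔ outside ∣ ≡ ∣ p ∣
∣remove∣ {p = inside  ∷ p} here        = ≡.refl
∣remove∣ {p = inside  ∷ p} (there x∈p) = ≡.cong ℕ.suc (∣remove∣ x∈p)
∣remove∣ {p = outside ∷ p} (there x∈p) = ∣remove∣ x∈p

∣p∪q∣+∣p∩q∣≡∣p∣+∣q∣ : ∀ {n} (p q : Subset n) →
  ∣ p Subset.∪ q ∣ ℕ.+ ∣ p Subset.∩ q ∣ ≡ ∣ p ∣ ℕ.+ ∣ q ∣
∣p∪q∣+∣p∩q∣≡∣p∣+∣q∣ []            []            = ≡.refl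
∣p∪q∣+∣p∩q∣≡∣p∣+∣q∣ (inside  ∷ p) (inside  ∷ q) = ≡.cong ℕ.suc
  (≡.trans (ℕ.+-suc _ _) (≡.trans (≡.cong ℕ.suc (∣p∪q∣+∣p∩q∣≡∣p∣+∣q∣ p q)) (≡.sym (ℕ.+-suc _ _))))
∣p∪q∣+∣p∩q∣≡∣p∣+∣q∣ (inside  ∷ p) (outside ∷ q) = ≡.cong ℕ.suc (∣p∪q∣+∣p∩q∣≡∣p∣+∣q∣ p q)
∣p∪q∣+∣p∩q∣≡∣p∣+∣q∣ (outside ∷ p) (inside  ∷ q) =
  ≡.trans (≡.cong ℕ.suc (∣p∪q∣+∣p∩q∣≡∣p∣+∣q∣ p q)) (≡.sym (ℕ.+-suc _ _))
∣p∪q∣+∣p∩q∣≡∣p∣+∣q∣ (outside ∷ p) (outside ∷ q) = ∣p∪q∣+∣p∩q∣≡∣p∣+∣q∣ p q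

∣∁p∣+∣p∣≡n : ∀ {n} (p : Subset n) → ∣ ∁ p ∣ ℕ.+ ∣ p ∣ ≡ n
∣∁p∣+∣p∣≡n p = ≡.trans (≡.cong (ℕ._+ ∣ p ∣) (∣∁p∣≡n∸∣p∣ p)) (ℕ.m∸n+n≡m (∣p∣≤n p))

-- Inclusion-exclusion with all subtractions moved across. With `q` as J and `∁ (p ∩ q)` counting
-- the dimension, the bound on Ω comes from |p ∪ q| ≤ n and its attainment from |p ∪ q| = n.
∣q∣+∣∁[p∩q]∣+∣p∣≡∣p∪q∣+n : ∀ {n} (p q : Subset n) →
  ∣ q ∣ ℕ.+ ∣ ∁ (p Subset.∩ q) ∣ ℕ.+ ∣ p ∣ ≡ ∣ p Subset.∪ q ∣ ℕ.+ n
∣q∣+∣∁[p∩q]∣+∣p∣≡∣p∪q∣+n {n} p q = begin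
  ∣ q ∣ ℕ.+ ∣ ∁ r ∣ ℕ.+ ∣ p ∣               ≡⟨ xy∙z≈zx∙y (∣ q ∣) (∣ ∁ r ∣) (∣ p ∣) ⟩
  ∣ p ∣ ℕ.+ ∣ q ∣ ℕ.+ ∣ ∁ r ∣               ≡⟨ ≡.cong (ℕ._+ ∣ ∁ r ∣) (∣p∪q∣+∣p∩q∣≡∣p∣+∣q∣ p q) ⟨
  ∣ p Subset.∪ q ∣ ℕ.+ ∣ r ∣ ℕ.+ ∣ ∁ r ∣    ≡⟨ ℕ.+-assoc (∣ p Subset.∪ q ∣) (∣ r ∣) (∣ ∁ r ∣) ⟩
  ∣ p Subset.∪ q ∣ ℕ.+ (∣ r ∣ ℕ.+ ∣ ∁ r ∣)  ≡⟨ ≡.cong (∣ p Subset.∪ q ∣ ℕ.+_) (≡.trans (ℕ.+-comm (∣ r ∣) (∣ ∁ r ∣)) (∣∁p∣+∣p∣≡n r)) ⟩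
  ∣ p Subset.∪ q ∣ ℕ.+ n                    ∎
  where
  open ≡.≡-Reasoning
  open CommutativeSemigroupProperties ℕ.+-commutativeSemigroup using (xy∙z≈zx∙y)
  r = p Subset.∩ q

shrink : ∀ {n m} (p : Subset n) → m ≤ ∣ p ∣ → ∃[ q ] q Subset.⊆ p × ∣ q ∣ ≡ m
shrink {n} {ℕ.zero} p _ = Subset.⊥ , (λ x∈⊥ → contradiction x∈⊥ ∉⊥) , ∣⊥∣≡0 n
shrink {m = ℕ.suc m} (inside ∷ p) (s≤s m≤p) =
  let q , q⊆p , eq = shrink p m≤p in
  inside ∷ q , (λ { here → here ; (there x∈q) → there (q⊆p x∈q) }) , ≡.cong ℕ.suc eq
shrink {m = ℕ.suc m} (outside ∷ p) m≤p =
  let q , q⊆p , eq = shrink p m≤p in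
  outside ∷ q , (λ { (there x∈q) → there (q⊆p x∈q) }) , eq

-- Arithmetic of defects

[e+n]-n≡e : ∀ e n → + (e ℕ.+ n) ℤ.- + n ≡ + e
[e+n]-n≡e e n = ≡.trans (ℤ.m-n≡m⊖n (e ℕ.+ n) n)
  (≡.trans (ℤ.⊖-≥ (ℕ.m≤n+m n e)) (≡.cong +_ (ℕ.m+n∸n≡m e n)))

x-n≤e : ∀ {x} e n → x ≤ e ℕ.+ n → + x ℤ.- + n ℤ.≤ + e
x-n≤e e n x≤e+n = ℤ.≤-trans (ℤ.+-monoˡ-≤ (ℤ.- + n) (ℤ.+≤+ x≤e+n)) (ℤ.≤-reflexive ([e+n]-n≡e e n))

e+n+∣p∣≡n+n : ∀ {n e} (p : Subset n) → e ≤ n → ∣ p ∣ ≡ n ∸ e → e ℕ.+ n ℕ.+ ∣ p ∣ ≡ n ℕ.+ n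
e+n+∣p∣≡n+n {n} {e} p e≤n ∣p∣≡ = ≡.trans (xy∙z≈xz∙y e n (∣ p ∣))
  (≡.cong (ℕ._+ n) (≡.trans (≡.cong (e ℕ.+_) ∣p∣≡) (ℕ.m+[n∸m]≡n e≤n)))
  where open CommutativeSemigroupProperties ℕ.+-commutativeSemigroup using (xy∙z≈xz∙y)

∣p∪q∣≡n : ∀ {n} (p q : Subset n) → (∀ {i} → i Subset.∉ p → i Subset.∈ q) → ∣ p Subset.∪ q ∣ ≡ n
∣p∪q∣≡n {n} p q ∁p⊆q = ℕ.≤-antisym (∣p∣≤n (p Subset.∪ q))
  (≡.subst (_≤ ∣ p Subset.∪ q ∣) (∣⊤∣≡n n) (p⊆q⇒∣p∣≤∣q∣ {p = Subset.⊤} λ {i} _ → i∈ i))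
  where
  i∈ : ∀ i → i Subset.∈ p Subset.∪ q
  i∈ i with i ∈? p
  ... | yes i∈p = x∈p∪q⁺ (inj₁ i∈p)
  ... | no  i∉p = x∈p∪q⁺ (inj₂ (∁p⊆q i∉p))

-- Values of a transposition

transpose[i,j,i]≡j : ∀ {n} (i j : Fin n) → PC.transpose i j i ≡ j
transpose[i,j,i]≡j i j with i ≟ i
... | yes _   = ≡.refl
... | no  i≢i = contradiction ≡.refl i≢i

transpose[i,j,j]≡i : ∀ {n} (i j : Fin n) → PC.transpose i j j ≡ i
transpose[i,j,j]≡i i j with j ≟ i
... | yes j≡i = j≡i
... | no  _ with j ≟ j
...   | yes _   = ≡.refl
...   | no  j≢j = contradiction ≡.refl j≢j

transpose-minimal : ∀ {n} (i j : Fin n) {l} → l ≢ i → l ≢ j → PC.transpose i j l ≡ l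
transpose-minimal i j {l} l≢i l≢j with l ≟ i
... | yes l≡i = contradiction l≡i l≢i
... | no  _ with l ≟ j
...   | yes l≡j = contradiction l≡j l≢j
...   | no  _   = ≡.refl

-- Linear algebra over K inside L

module Span {k ℓk c ℓ : Level} (E : FieldExtension k ℓk c ℓ) where

  open FieldExtension E
  open LinearAlgebra E hiding (_∩_; T; _·_)
  open L using (_≈_; _≉_; _+_; _*_; 0#; 1#)
  open Sum L.+-commutativeMonoid using (sum-cong-≋; sum-replicate-zero; ∑-distrib-+; sum-permute; sum-remove)
  open SemiringSum L.semiring using (*-distribˡ-sum)
  open import Relation.Binary.Reasoning.Setoid L.setoid

  private
    variable
      n : ℕ
      p q r : Level
      x y : L.Carrier

    open CommutativeSemigroupProperties L.+-commutativeSemigroup using (interchange; xy∙z≈xz∙y)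

    distrib-swap : ∀ s t x y → (s + t) * x + y ≈ s * x + y + t * x
    distrib-swap s t x y = L.trans (L.+-congʳ (L.distribʳ x s t)) (xy∙z≈xz∙y _ _ _)

    collect-shear : ∀ s x t y z u → s * (x + t * y) + (z + u * y) ≈ s * x + z + (s * t + u) * y
    collect-shear s x t y z u = begin
      s * (x + t * y) + (z + u * y)           ≈⟨ L.+-congʳ (L.distribˡ s x _) ⟩
      (s * x + s * (t * y)) + (z + u * y)     ≈⟨ interchange _ _ _ _ ⟩
      (s * x + z) + (s * (t * y) + u * y)     ≈⟨ L.+-congˡ (L.+-congʳ (L.*-assoc s t y)) ⟨
      (s * x + z) + (s * t * y + u * y)       ≈⟨ L.+-congˡ (L.distribʳ y _ u) ⟨
      s * x + z + (s * t + u) * y             ∎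

    shear-+ : ∀ x s y t z → (x + s * z) + (y + t * z) ≈ (x + y) + (s + t) * z
    shear-+ x s y t z = L.trans (interchange _ _ _ _) (L.+-congˡ (L.sym (L.distribʳ z s t)))

    shear-* : ∀ s x t z → s * (x + t * z) ≈ s * x + (s * t) * z
    shear-* s x t z = L.trans (L.distribˡ s x _) (L.+-congˡ (L.sym (L.*-assoc s t z)))

  ι-inverse : ∀ {s} (s≉0 : ¬ s K.≈ K.0#) x → ι (s K.⁻¹[ s≉0 ]) * (ι s * x) ≈ x
  ι-inverse {s} s≉0 x = begin
    ι s⁻¹ * (ι s * x)     ≈⟨ L.*-assoc _ _ _ ⟨
    ι s⁻¹ * ι s * x       ≈⟨ L.*-congʳ (ι.*-homo s⁻¹ s) ⟨
    ι (s⁻¹ K.* s) * x     ≈⟨ L.*-congʳ (ι.⟦⟧-cong (proj₁ (proj₂ (K.invertible s≉0)))) ⟩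
    ι K.1# * x            ≈⟨ L.*-congʳ ι.1#-homo ⟩
    1# * x                ≈⟨ L.*-identityˡ x ⟩
    x                     ∎
    where s⁻¹ = s K.⁻¹[ s≉0 ]

  0·≈0 : ∀ {s} x → s K.≈ K.0# → ι s * x ≈ 0#
  0·≈0 x s≈0 = L.trans (L.*-congʳ (L.trans (ι.⟦⟧-cong s≈0) ι.0#-homo)) (L.zeroˡ x)

  +-0·≈ : ∀ {s} x y → s K.≈ K.0# → x + ι s * y ≈ x
  +-0·≈ x y s≈0 = L.trans (L.+-congˡ (0·≈0 y s≈0)) (L.+-identityʳ x)

  x+ι[-1]*x≈0 : ∀ x → x + ι (K.- K.1#) * x ≈ 0#
  x+ι[-1]*x≈0 x = begin
    x + ι (K.- K.1#) * x   ≈⟨ L.+-congˡ (L.*-congʳ (L.trans (ι.-‿homo K.1#) (L.-‿cong ι.1#-homo))) ⟩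
    x + L.- 1# * x         ≈⟨ L.+-congˡ (-1*x≈-x x) ⟩
    x + L.- x              ≈⟨ L.-‿inverseʳ x ⟩
    0#                     ∎
    where open import Algebra.Properties.Ring L.ring using (-1*x≈-x)

  lc-cong : ∀ {n} {a b : Vector K.Carrier n} {v w} → (∀ i → a i K.≈ b i) → (∀ i → v i ≈ w i) →
            linearCombination a v ≈ linearCombination b w
  lc-cong a≈b v≈w = sum-cong-≋ λ i → L.*-cong (ι.⟦⟧-cong (a≈b i)) (v≈w i)

  lc-zero : ∀ {n} {a : Vector K.Carrier n} v → (∀ i → a i K.≈ K.0#) →
            linearCombination a v ≈ 0#
  lc-zero {n} v a≈0 = L.trans (sum-cong-≋ λ i → 0·≈0 (v i) (a≈0 i)) (sum-replicate-zero n)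

  lc-+ : ∀ {n} a b (v : Vector L.Carrier n) →
         linearCombination (λ i → a i K.+ b i) v ≈ linearCombination a v + linearCombination b v
  lc-+ a b v = L.trans
    (sum-cong-≋ λ i → L.trans (L.*-congʳ (ι.+-homo (a i) (b i))) (L.distribʳ (v i) _ _))
    (∑-distrib-+ (λ i → ι (a i) * v i) (λ i → ι (b i) * v i))

  lc-* : ∀ {n} s a (v : Vector L.Carrier n) →
         linearCombination (λ i → s K.* a i) v ≈ ι s * linearCombination a v
  lc-* s a v = L.trans
    (sum-cong-≋ λ i → L.trans (L.*-congʳ (ι.*-homo s (a i))) (L.*-assoc _ _ (v i)))
    (L.sym (*-distribˡ-sum (ι s) (λ i → ι (a i) * v i)))

  lc-updateAt : ∀ {n} a (v : Vector L.Carrier n) i s →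
                linearCombination (updateAt a i (K._+ s)) v ≈ linearCombination a v + ι s * v i
  lc-updateAt a v zero s = begin
    ι (a zero K.+ s) * v zero + R          ≈⟨ L.+-congʳ (L.*-congʳ (ι.+-homo _ s)) ⟩
    (ι (a zero) + ι s) * v zero + R        ≈⟨ distrib-swap _ _ _ _ ⟩
    ι (a zero) * v zero + R + ι s * v zero ∎
    where
    R = linearCombination (a ∘ suc) (v ∘ suc)
  lc-updateAt a v (suc i) s =
    L.trans (L.+-congˡ (lc-updateAt (a ∘ suc) (v ∘ suc) i s)) (L.sym (L.+-assoc _ _ _))

  -- Every term is displaced along the same `x`, so the displacements add up to one multiple of `x`.
  -- Its coefficient is the sum of the products of `a` and `b`, but only its existence matters
  -- later.
  lc-shear : ∀ {n} a (v : Vector L.Carrier n) (b : Vector K.Carrier n) x →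
             ∃[ s ] linearCombination a (λ i → v i + ι (b i) * x) ≈ linearCombination a v + ι s * x
  lc-shear {ℕ.zero} a v b x = K.0# , L.sym (+-0·≈ 0# x K.refl)
  lc-shear {ℕ.suc n} a v b x with lc-shear (a ∘ suc) (v ∘ suc) (b ∘ suc) x
  ... | s , eq = a zero K.* b zero K.+ s , (begin
    ι a₀ * (v₀ + ι b₀ * x) + linearCombination (a ∘ suc) _ ≈⟨ L.+-congˡ eq ⟩
    ι a₀ * (v₀ + ι b₀ * x) + (R + ι s * x)  ≈⟨ collect-shear _ _ _ _ _ _ ⟩
    ι a₀ * v₀ + R + (ι a₀ * ι b₀ + ι s) * x
      ≈⟨ L.+-congˡ (L.*-congʳ (L.trans (ι.+-homo _ s) (L.+-congʳ (ι.*-homo a₀ b₀)))) ⟨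
    ι a₀ * v₀ + R + ι (a₀ K.* b₀ K.+ s) * x ∎)
    where
    a₀ = a zero
    b₀ = b zero
    v₀ = v zero
    R = linearCombination (a ∘ suc) (v ∘ suc)

  lc-∈ : ∀ {n} {a : Vector K.Carrier n} {v} (S : Subspace p) → (∀ i → ι (a i) * v i ∈ ⟦ S ⟧) → linearCombination a v ∈ ⟦ S ⟧
  lc-∈ {n = ℕ.zero}  S _ = Subspace.0∈ S
  lc-∈ {n = ℕ.suc n} S t = Subspace.+-closed S (t zero) (lc-∈ S (t ∘ suc))

  -- Spans and subspaces given by coordinates

  private
    ⟨⟩-cons : (X : Pred L.Carrier p) → ∀ s → x ∈ X → y ∈ ⟨ X ⟩ → ι s * x + y ∈ ⟨ X ⟩
    ⟨⟩-cons {x = x} X s x∈X (m , a , v , v∈X , y≈) =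
      ℕ.suc m ,
      (λ { zero → s ; (suc i) → a i }) , (λ { zero → x ; (suc i) → v i }) ,
      (λ { zero → x∈X ; (suc i) → v∈X i }) , L.+-congˡ y≈

    ⟨⟩-respects : (X : Pred L.Carrier p) → x ≈ y → x ∈ ⟨ X ⟩ → y ∈ ⟨ X ⟩
    ⟨⟩-respects X x≈y (m , a , v , v∈X , x≈) = m , a , v , v∈X , L.trans (L.sym x≈y) x≈

    ⟨⟩-lc+ : (X : Pred L.Carrier p) → ∀ {m} a (v : Vector L.Carrier m) → (∀ i → v i ∈ X) →
             y ∈ ⟨ X ⟩ → linearCombination a v + y ∈ ⟨ X ⟩
    ⟨⟩-lc+ X {m = ℕ.zero}  a v v∈X y∈ = ⟨⟩-respects X (L.sym (L.+-identityˡ _)) y∈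
    ⟨⟩-lc+ X {m = ℕ.suc m} a v v∈X y∈ = ⟨⟩-respects X (L.sym (L.+-assoc _ _ _))
      (⟨⟩-cons X (a zero) (v∈X zero) (⟨⟩-lc+ X (a ∘ suc) (v ∘ suc) (v∈X ∘ suc) y∈))

  span : Pred L.Carrier p → Subspace (k ⊔ c ⊔ ℓ ⊔ p)
  span X = record
    { ⟦_⟧      = ⟨ X ⟩
    ; respects = ⟨⟩-respects X
    ; 0∈       = 0 , (λ ()) , (λ ()) , (λ ()) , L.refl
    ; +-closed = λ (m , a , v , v∈X , x≈) y∈ →
        ⟨⟩-respects X (L.+-congʳ (L.sym x≈)) (⟨⟩-lc+ X a v v∈X y∈)
    ; ·-closed = λ s (m , a , v , v∈X , x≈) →
        m , (λ i → s K.* a i) , v , v∈X , L.trans (L.*-congˡ x≈) (L.sym (lc-* s a v))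
    }

  ⊆-span : (X : Pred L.Carrier p) → X ⊆ ⟨ X ⟩
  ⊆-span X {x} x∈X = ⟨⟩-respects X (L.trans (L.+-identityʳ _) (L.trans (L.*-congʳ ι.1#-homo) (L.*-identityˡ x)))
    (⟨⟩-cons X K.1# x∈X (Subspace.0∈ (span X)))

  span-least : (X : Pred L.Carrier p) (S : Subspace q) → X ⊆ ⟦ S ⟧ → ⟨ X ⟩ ⊆ ⟦ S ⟧
  span-least X S X⊆S (m , a , v , v∈X , x≈) =
    Subspace.respects S (L.sym x≈) (lc-∈ S λ i → Subspace.·-closed S (a i) (X⊆S (v∈X i)))

  -- Elements of `⟨_⟩` come with arbitrary finite families; here each index has one coefficient, so
  -- coordinates can be compared. `R` collects the indices whose coefficient is forced to vanish.
  combinations : ∀ {n} → Vector L.Carrier n → Pred (Fin n) r → Subspace (k ⊔ ℓk ⊔ ℓ ⊔ r)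
  combinations v R = record
    { ⟦_⟧      = λ x → ∃[ a ] (∀ i → i ∈ R → a i K.≈ K.0#) × x ≈ linearCombination a v
    ; respects = λ x≈y (a , a≈0 , x≈) → a , a≈0 , L.trans (L.sym x≈y) x≈
    ; 0∈       = replicate _ K.0# , (λ _ _ → K.refl) , L.sym (lc-zero v λ _ → K.refl)
    ; +-closed = λ (a , a≈0 , x≈) (b , b≈0 , y≈) →
        (λ i → a i K.+ b i) ,
        (λ i i∈R → K.trans (K.+-cong (a≈0 i i∈R) (b≈0 i i∈R)) (K.+-identityˡ K.0#)) ,
        L.trans (L.+-cong x≈ y≈) (L.sym (lc-+ a b v))
    ; ·-closed = λ s (a , a≈0 , x≈) →
        (λ i → s K.* a i) ,
        (λ i i∈R → K.trans (K.*-congˡ (a≈0 i i∈R)) (K.zeroʳ s)) ,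
        L.trans (L.*-congˡ x≈) (L.sym (lc-* s a v))
    }

  -- The unit coordinate vector is written as an update of the zero vector by addition, which brings
  -- it under `lc-updateAt`.
  lc-unit : ∀ {n} (v : Vector L.Carrier n) i →
            linearCombination (updateAt (replicate n K.0#) i (K._+ K.1#)) v ≈ v i
  lc-unit v i = begin
    linearCombination (updateAt (replicate _ K.0#) i (K._+ K.1#)) v
      ≈⟨ lc-updateAt (replicate _ K.0#) v i K.1# ⟩
    linearCombination (replicate _ K.0#) v + ι K.1# * v i
      ≈⟨ L.+-cong (lc-zero v λ _ → K.refl) (L.*-congʳ ι.1#-homo) ⟩
    0# + 1# * v i
      ≈⟨ L.trans (L.+-identityˡ _) (L.*-identityˡ _) ⟩
    v i ∎

  ∈-combinations : ∀ {n} (v : Vector L.Carrier n) {R : Pred (Fin n) r} i → i ∉ R →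
                   v i ∈ ⟦ combinations v R ⟧
  ∈-combinations v {R} i i∉R =
    updateAt (replicate _ K.0#) i (K._+ K.1#) ,
    (λ j j∈R → K.reflexive (updateAt-minimal j i _ λ { ≡.refl → i∉R j∈R })) ,
    L.sym (lc-unit v i)

  independent⇒unique : ∀ {n} {v : Vector L.Carrier n} → LinearlyIndependent v → ∀ a b →
                       linearCombination a v ≈ linearCombination b v → ∀ i → a i K.≈ b i
  independent⇒unique {v = v} ind a b eq i =
    x∙y⁻¹≈ε⇒x≈y (a i) (b i) (K.trans (K.+-congˡ (K.sym (-1*x≈-x (b i)))) (ind (λ j → a j K.+ K.- K.1# K.* b j) (begin
      linearCombination (λ j → a j K.+ K.- K.1# K.* b j) v ≈⟨ lc-+ a _ v ⟩
      linearCombination a v + linearCombination (λ j → K.- K.1# K.* b j) v ≈⟨ L.+-congʳ eq ⟩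
      linearCombination b v + linearCombination (λ j → K.- K.1# K.* b j) v ≈⟨ lc-+ b _ v ⟨
      linearCombination (λ j → b j K.+ K.- K.1# K.* b j) v
        ≈⟨ lc-zero v (λ j → K.trans (K.+-congˡ (-1*x≈-x (b j))) (K.-‿inverseʳ (b j))) ⟩
      0# ∎) i))
    where
    open GroupProperties K.+-group using (x∙y⁻¹≈ε⇒x≈y)
    open import Algebra.Properties.Ring K.ring using (-1*x≈-x)

  independent⇒≉0 : ∀ {n} {v : Vector L.Carrier n} → LinearlyIndependent v → ∀ i → v i ≉ 0#
  independent⇒≉0 {v = v} ind i vᵢ≈0 = K.0≉1 (K.trans
    (K.sym (ind _ (L.trans (lc-unit v i) vᵢ≈0) i))
    (K.trans (K.reflexive (updateAt-updates i _)) (K.+-identityˡ K.1#)))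

  -- Enlarging subspaces and cancelling in them

  -- This is the sum of `S` and the line through `g`. Asking for a scalar that moves `x` back into
  -- `S` avoids quantifying over elements of L, so iterating the construction stays at level
  -- `k ⊔ p`.
  adjoin : Subspace p → L.Carrier → Subspace (k ⊔ p)
  adjoin S g = record
    { ⟦_⟧      = λ x → ∃[ s ] x + ι s * g ∈ ⟦ S ⟧
    ; respects = λ x≈y (s , x∈) → s , S.respects (L.+-congʳ x≈y) x∈
    ; 0∈       = K.0# , S.respects (L.sym (+-0·≈ 0# g K.refl)) S.0∈
    ; +-closed = λ {x} {y} (s , x∈) (t , y∈) → s K.+ t ,
        S.respects (L.trans (shear-+ x _ y _ g) (L.+-congˡ (L.*-congʳ (L.sym (ι.+-homo s t)))))
          (S.+-closed x∈ y∈)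
    ; ·-closed = λ s {x} (t , x∈) → s K.* t ,
        S.respects (L.trans (shear-* _ x _ g) (L.+-congˡ (L.*-congʳ (L.sym (ι.*-homo s t)))))
          (S.·-closed s x∈)
    }
    where
    module S = Subspace S

  ⊆-adjoin : (S : Subspace p) (g : L.Carrier) → ⟦ S ⟧ ⊆ ⟦ adjoin S g ⟧
  ⊆-adjoin S g {x} x∈S = K.0# , Subspace.respects S (L.sym (+-0·≈ x g K.refl)) x∈S

  ∈-adjoin : (S : Subspace p) (g : L.Carrier) → g ∈ ⟦ adjoin S g ⟧
  ∈-adjoin S g = K.- K.1# , Subspace.respects S (L.sym (x+ι[-1]*x≈0 g)) (Subspace.0∈ S)

  +-∈-cancelʳ : ∀ (S : Subspace p) {x y} → x + y ∈ ⟦ S ⟧ → y ∈ ⟦ S ⟧ → x ∈ ⟦ S ⟧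
  +-∈-cancelʳ S {x} {y} x+y∈S y∈S = S.respects eq (S.+-closed x+y∈S (S.·-closed (K.- K.1#) y∈S))
    where
    module S = Subspace S
    eq : (x + y) + ι (K.- K.1#) * y ≈ x
    eq = begin
      (x + y) + ι (K.- K.1#) * y  ≈⟨ L.+-assoc x y _ ⟩
      x + (y + ι (K.- K.1#) * y)  ≈⟨ L.+-congˡ (x+ι[-1]*x≈0 y) ⟩
      x + 0#                      ≈⟨ L.+-identityʳ x ⟩
      x                           ∎

  ·-∈-cancel : ∀ (S : Subspace p) {s x} → ¬ s K.≈ K.0# → ι s * x ∈ ⟦ S ⟧ → x ∈ ⟦ S ⟧
  ·-∈-cancel S s≉0 sx∈S = Subspace.respects S (ι-inverse s≉0 _) (Subspace.·-closed S _ sx∈S)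

  lc-∈-span : ∀ {n} {a : Vector K.Carrier n} {v} (X : Pred L.Carrier p) →
              (∀ i → a i K.≈ K.0# ⊎ v i ∈ X) → linearCombination a v ∈ ⟨ X ⟩
  lc-∈-span {a = a} {v} X h = lc-∈ (span X) term
    where
    term : ∀ i → ι (a i) * v i ∈ ⟨ X ⟩
    term i with h i
    ... | inj₁ aᵢ≈0 = Subspace.respects (span X) (L.sym (0·≈0 (v i) aᵢ≈0)) (Subspace.0∈ (span X))
    ... | inj₂ vᵢ∈X = Subspace.·-closed (span X) (a i) (⊆-span X vᵢ∈X)

  -- Ordered bases: coordinates, relabelling and shears

  Range : ∀ {n} → Vector L.Carrier n → Pred L.Carrier ℓ
  Range v y = ∃[ i ] v i ≈ y

  Others : ∀ {n} → Vector L.Carrier n → Fin n → Pred L.Carrier ℓ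
  Others v i y = ∃[ j ] j ≢ i × v j ≈ y

  coordinates : {S : Subspace p} (ℬ : OrderedBasis S n) → ⟦ S ⟧ ⊆ ⟦ combinations (vec ℬ) ∅ ⟧
  coordinates ℬ x∈S = span-least (Range (vec ℬ)) (combinations (vec ℬ) ∅)
    (λ (i , vᵢ≈y) → Subspace.respects (combinations (vec ℬ) ∅) vᵢ≈y (∈-combinations (vec ℬ) i λ ()))
    (OrderedBasis.spanning ℬ x∈S)

  -- Membership in the span of the others gives a second expansion whose coefficient at `i` is zero,
  -- and expansions are unique.
  coefficient≈0 : ∀ {n} {v : Vector L.Carrier n} → LinearlyIndependent v → ∀ a i →
                  linearCombination a v ∈ ⟨ Others v i ⟩ → a i K.≈ K.0#
  coefficient≈0 {v = v} ind a i x∈ with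
    span-least (Others v i) (combinations v (_≡ i))
      (λ (j , j≢i , vⱼ≈y) → Subspace.respects (combinations v (_≡ i)) vⱼ≈y (∈-combinations v j j≢i)) x∈
  ... | b , b≈0 , x≈ = K.trans (independent⇒unique ind a b x≈ i) (b≈0 i ≡.refl)

  permuteBasis : {S : Subspace p} → OrderedBasis S n → Permutation′ n → OrderedBasis S n
  permuteBasis {S = S} ℬ π = record
    { vec         = λ i → vec ℬ (π ⟨$⟩ʳ i)
    ; vec∈        = λ i → OrderedBasis.vec∈ ℬ (π ⟨$⟩ʳ i)
    ; independent = λ a eq i → K.trans (K.reflexive (≡.cong a (≡.sym (inverseˡ π))))
        (OrderedBasis.independent ℬ (λ j → a (π ⟨$⟩ˡ j)) (L.trans (sum-permute (λ j → ι (a (π ⟨$⟩ˡ j)) * vec ℬ j) π)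
          (L.trans (lc-cong {v = λ i → vec ℬ (π ⟨$⟩ʳ i)} (λ i → K.reflexive (≡.cong a (inverseˡ π))) (λ _ → L.refl)) eq)) (π ⟨$⟩ʳ i))
    ; spanning    = span-least (Range (vec ℬ)) (span X) (λ (j , vⱼ≈y) →
        ⊆-span X (π ⟨$⟩ˡ j , L.trans (L.reflexive (≡.cong (vec ℬ) (inverseʳ π))) vⱼ≈y))
        ∘ OrderedBasis.spanning ℬ
    }
    where
    X = Range (λ i → vec ℬ (π ⟨$⟩ʳ i))

  shearBasis : {S : Subspace p} (ℬ : OrderedBasis S n) (b : Vector K.Carrier n) (i : Fin n) →
               b i K.≈ K.0# → OrderedBasis S n
  shearBasis {n = n} {S = S} ℬ b i bᵢ≈0 = record
    { vec         = u
    ; vec∈        = λ j → Subspace.+-closed S (vec∈ j) (Subspace.·-closed S (b j) (vec∈ i))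
    ; independent = independent′
    ; spanning    = λ x∈S → span-least (Range v) (span X) (λ (j , vⱼ≈y) → Subspace.respects (span X) vⱼ≈y (v∈ j)) (spanning x∈S)
    }
    where
    open OrderedBasis ℬ renaming (vec to v)
    u : Vector L.Carrier n
    u j = v j + ι (b j) * v i
    X = Range u
    vᵢ∈ : v i ∈ ⟨ X ⟩
    vᵢ∈ = ⊆-span X (i , +-0·≈ _ _ bᵢ≈0)
    v∈ : ∀ j → v j ∈ ⟨ X ⟩
    v∈ j = +-∈-cancelʳ (span X) (⊆-span X (j , L.refl)) (Subspace.·-closed (span X) (b j) vᵢ∈)
    -- Over `v` the relation has the coefficients `a`, except that `s` is added at `i`. Hence `a j`
    -- vanishes for `j ≢ i`; since `b i` is zero the two combinations then agree term by term, and
    -- `a i` vanishes too.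
    independent′ : LinearlyIndependent u
    independent′ a eq = independent a (L.trans (sum-cong-≋ same) eq)
      where
      s = proj₁ (lc-shear a v b (v i))
      others≈0 : ∀ j → j ≢ i → a j K.≈ K.0#
      others≈0 j j≢i = K.trans (K.reflexive (≡.sym (updateAt-minimal j i a j≢i)))
        (independent (updateAt a i (K._+ s))
          (L.trans (lc-updateAt a v i s) (L.trans (L.sym (proj₂ (lc-shear a v b (v i)))) eq)) j)
      same : ∀ j → ι (a j) * v j ≈ ι (a j) * u j
      same j with j ≟ i
      ... | yes ≡.refl = L.*-congˡ (L.sym (+-0·≈ _ _ bᵢ≈0))
      ... | no  j≢i    = L.trans (0·≈0 _ (others≈0 j j≢i)) (L.sym (0·≈0 _ (others≈0 j j≢i)))

  -- Hyperplanes and the Steinitz bound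

  module _ (_≟0 : ∀ s → Dec (s K.≈ K.0#)) where

    scalar≈0 : ∀ (S : Subspace p) {s x} → x ∉ ⟦ S ⟧ → ι s * x ∈ ⟦ S ⟧ → s K.≈ K.0#
    scalar≈0 S {s} x∉S sx∈S with s ≟0
    ... | yes s≈0 = s≈0
    ... | no  s≉0 = contradiction (·-∈-cancel S s≉0 sx∈S) x∉S

    -- Removing the `i`-th term from the expansion of `x` leaves an element of `S`, so that term
    -- lies in `S` as well; as `vec ℬ i` does not, its coefficient is zero.
    ∈-span-Others : ∀ {B : Subspace p} (ℬ : OrderedBasis B n) i (S : Subspace q) →
      (∀ j → j ≢ i → vec ℬ j ∈ ⟦ S ⟧) → vec ℬ i ∉ ⟦ S ⟧ →
      ∀ {x} → x ∈ ⟦ B ⟧ → x ∈ ⟦ S ⟧ → x ∈ ⟨ Others (vec ℬ) i ⟩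
    ∈-span-Others {n = n} ℬ i S others∈S vᵢ∉S {x} x∈B x∈S =
      Subspace.respects (span (Others v i)) (L.sym x≈) (lc-∈-span (Others v i) term)
      where
      v = vec ℬ
      a = proj₁ (coordinates ℬ x∈B)
      x≈ : x ≈ linearCombination a v
      x≈ = proj₂ (proj₂ (coordinates ℬ x∈B))
      -- The coefficient at `i` is cancelled by adding its negative, so that `lc-updateAt` computes
      -- the new combination.
      a₀ : Vector K.Carrier n
      a₀ = updateAt a i (K._+ K.- a i)
      a₀ᵢ≈0 : a₀ i K.≈ K.0#
      a₀ᵢ≈0 = K.trans (K.reflexive (updateAt-updates i a)) (K.-‿inverseʳ (a i))
      a₀v∈S : ∀ j → ι (a₀ j) * v j ∈ ⟦ S ⟧
      a₀v∈S j with j ≟ i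
      ... | yes ≡.refl = Subspace.respects S (L.sym (0·≈0 (v i) a₀ᵢ≈0)) (Subspace.0∈ S)
      ... | no  j≢i    = Subspace.·-closed S (a₀ j) (others∈S j j≢i)
      a₀v≈ : linearCombination a₀ v ≈ ι (K.- a i) * v i + x
      a₀v≈ = L.trans (lc-updateAt a v i (K.- a i)) (L.trans (L.+-comm _ _) (L.+-congˡ (L.sym x≈)))
      -aᵢvᵢ∈S : ι (K.- a i) * v i ∈ ⟦ S ⟧
      -aᵢvᵢ∈S = +-∈-cancelʳ S (Subspace.respects S a₀v≈ (lc-∈ {a = a₀} {v} S a₀v∈S)) x∈S
      aᵢ≈0 : a i K.≈ K.0#
      aᵢ≈0 = K.trans (K.sym (K.+-identityʳ (a i))) (K.trans
        (K.+-congˡ (K.sym (scalar≈0 S vᵢ∉S -aᵢvᵢ∈S))) (K.-‿inverseʳ (a i)))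
      term : ∀ j → a j K.≈ K.0# ⊎ v j ∈ Others v i
      term j with j ≟ i
      ... | yes ≡.refl = inj₁ aᵢ≈0
      ... | no  j≢i    = inj₂ (j , j≢i , L.refl)

    -- Gaussian elimination by induction on `Q`. A coordinate outside `Q` vanishes on all `u i`. A
    -- coordinate in `Q` either happens to vanish on all of them or provides a pivot, which is
    -- dropped after that coordinate has been cleared from the other vectors.
    steinitz : ∀ {r} (Q : Subset r) (w : Vector L.Carrier r) {m} (u : Vector L.Carrier m) →
               LinearlyIndependent u → (∀ i → u i ∈ ⟦ combinations w (Subset._∉ Q) ⟧) → m ≤ ∣ Q ∣
    steinitz [] w {ℕ.zero}  u ind u∈ = z≤n
    steinitz [] w {ℕ.suc m} u ind u∈ = contradiction (proj₂ (proj₂ (u∈ zero))) (independent⇒≉0 {v = u} ind zero)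
    steinitz (outside ∷ Q) w u ind u∈ = steinitz Q (w ∘ suc) u ind λ i →
      let a , a≈0 , uᵢ≈ = u∈ i in
      a ∘ suc , (λ j j∉Q → a≈0 (suc j) λ { (there j∈Q) → j∉Q j∈Q }) ,
      L.trans uᵢ≈ (L.trans (L.+-congʳ (0·≈0 _ (a≈0 zero λ ()))) (L.+-identityˡ _))
    steinitz (inside ∷ Q) w {m} u ind u∈ with any? (λ i → ¬? (coeff i ≟0))
      where
      coeff : Fin m → K.Carrier
      coeff i = proj₁ (u∈ i) zero
    ... | no all≈0 = ℕ.m≤n⇒m≤1+n (steinitz Q (w ∘ suc) u ind λ i →
      let a , a≈0 , uᵢ≈ = u∈ i in
      a ∘ suc , (λ j j∉Q → a≈0 (suc j) λ { (there j∈Q) → j∉Q j∈Q }) ,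
      L.trans uᵢ≈ (L.trans
        (L.+-congʳ (0·≈0 _ (decidable-stable (a zero ≟0) λ a₀≉0 → all≈0 (i , a₀≉0))))
        (L.+-identityˡ _)))
    steinitz (inside ∷ Q) w {ℕ.suc m} u ind u∈ | yes (i , aᵢ₀≉0) =
      s≤s (steinitz Q (w ∘ suc) u′ ind′ u′∈)
      where
      a : Fin (ℕ.suc m) → Vector K.Carrier _
      a j = proj₁ (u∈ j)
      -- Division by the pivot entry makes coordinate `zero` of `u′ j` vanish, as `b₀≈0` checks.
      t : Vector K.Carrier m
      t j = K.- (a (punchIn i j) zero K.* (a i zero K.⁻¹[ aᵢ₀≉0 ]))
      u′ : Vector L.Carrier m
      u′ j = u (punchIn i j) + ι (t j) * u i
      -- A relation among the `u′ j` becomes one among the vectors of `u` once the collected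
      -- coefficient `s` is inserted at the pivot.
      ind′ : LinearlyIndependent u′
      ind′ b eq j with lc-shear b (u ∘ punchIn i) t (u i)
      ... | s , shear = K.trans (K.reflexive (≡.sym (insertAt-punchIn b i s j)))
        (ind (insertAt b i s) (begin
          linearCombination (insertAt b i s) u
            ≈⟨ sum-remove {i = i} (λ l → ι (insertAt b i s l) * u l) ⟩
          ι (insertAt b i s i) * u i + linearCombination (insertAt b i s ∘ punchIn i) (u ∘ punchIn i)
            ≈⟨ L.+-cong (L.*-congʳ (ι.⟦⟧-cong (K.reflexive (insertAt-lookup b i s))))
                 (lc-cong (λ l → K.reflexive (insertAt-punchIn b i s l)) (λ _ → L.refl)) ⟩
          ι s * u i + linearCombination b (u ∘ punchIn i)
            ≈⟨ L.+-comm _ _ ⟩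
          linearCombination b (u ∘ punchIn i) + ι s * u i
            ≈⟨ shear ⟨
          linearCombination b u′
            ≈⟨ eq ⟩
          0# ∎) (punchIn i j))
      u′∈ : ∀ j → u′ j ∈ ⟦ combinations (w ∘ suc) (Subset._∉ Q) ⟧
      u′∈ j = b ∘ suc , (λ l l∉Q → b≈0 l λ { (there l∈Q) → l∉Q l∈Q }) , (begin
        u′ j                                            ≈⟨ L.+-cong (proj₂ (proj₂ (u∈ j′))) (L.*-congˡ (proj₂ (proj₂ (u∈ i)))) ⟩
        linearCombination (a j′) w + ι (t j) * linearCombination (a i) w
                                                        ≈⟨ L.+-congˡ (lc-* (t j) (a i) w) ⟨
        linearCombination (a j′) w + linearCombination (λ l → t j K.* a i l) w
                                                        ≈⟨ lc-+ (a j′) (λ l → t j K.* a i l) w ⟨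
        linearCombination b w                           ≈⟨ L.+-congʳ (0·≈0 _ b₀≈0) ⟩
        0# + linearCombination (b ∘ suc) (w ∘ suc)      ≈⟨ L.+-identityˡ _ ⟩
        linearCombination (b ∘ suc) (w ∘ suc)           ∎)
        where
        open import Algebra.Properties.Ring K.ring using (-‿distribˡ-*)
        j′ = punchIn i j
        b : Vector K.Carrier _
        b l = a j′ l K.+ t j K.* a i l
        b≈0 : ∀ l → suc l Subset.∉ inside ∷ Q → b (suc l) K.≈ K.0#
        b≈0 l l∉Q = K.trans (K.+-cong (proj₁ (proj₂ (u∈ j′)) (suc l) l∉Q)
          (K.trans (K.*-congˡ (proj₁ (proj₂ (u∈ i)) (suc l) l∉Q)) (K.zeroʳ _))) (K.+-identityˡ K.0#)
        inv = a i zero K.⁻¹[ aᵢ₀≉0 ]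
        t*aᵢ₀ : t j K.* a i zero K.≈ K.- a j′ zero
        t*aᵢ₀ = K.trans (K.sym (-‿distribˡ-* _ _)) (K.-‿cong (K.trans (K.*-assoc _ inv _)
          (K.trans (K.*-congˡ (proj₁ (proj₂ (K.invertible aᵢ₀≉0)))) (K.*-identityʳ _))))
        b₀≈0 : b zero K.≈ K.0#
        b₀≈0 = K.trans (K.+-congˡ t*aᵢ₀) (K.-‿inverseʳ _)

    -- Greedily adjoining the g j keeps x outside S; a g j that would
    -- bring x in is congruent to a multiple of x instead, so the result is a
    -- hyperplane of the span of S, x and the g j.
    separate : ExcludedMiddle (k ⊔ q) → ∀ {m} (g : Vector L.Carrier m) (S : Subspace (k ⊔ q)) {x} →
               x ∉ ⟦ S ⟧ → ∃[ S′ ] ⟦ S ⟧ ⊆ ⟦ S′ ⟧ × x ∉ ⟦ S′ ⟧ × (∀ j → ∃[ s ] g j + ι s * x ∈ ⟦_⟧ {p = k ⊔ q} S′)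
    separate em {ℕ.zero} g S x∉S = S , (λ x∈S → x∈S) , x∉S , λ ()
    separate {q} em {ℕ.suc m} g S {x} x∉S with em {x ∈ ⟦ adjoin S (g zero) ⟧}
    ... | no x∉ =
      let S′ , S⊆S′ , x∉S′ , g∈ = separate {q} em (g ∘ suc) (adjoin S (g zero)) x∉ in
      S′ , (λ y∈S → S⊆S′ (⊆-adjoin S (g zero) y∈S)) , x∉S′ , λ
        { zero    → K.0# , Subspace.respects S′ (L.sym (+-0·≈ _ x K.refl)) (S⊆S′ (∈-adjoin S (g zero)))
        ; (suc j) → g∈ j }
    ... | yes (s , x+sg∈S) =
      let S′ , S⊆S′ , x∉S′ , g∈ = separate {q} em (g ∘ suc) S x∉S in
      S′ , S⊆S′ , x∉S′ , λ
        { zero    → s⁻¹ , S⊆S′ (S.respects eq (S.·-closed s⁻¹ x+sg∈S))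
        ; (suc j) → g∈ j }
      where
      module S = Subspace S
      s≉0 : ¬ s K.≈ K.0#
      s≉0 s≈0 = x∉S (S.respects (+-0·≈ x (g zero) s≈0) x+sg∈S)
      s⁻¹ = s K.⁻¹[ s≉0 ]
      eq : ι s⁻¹ * (x + ι s * g zero) ≈ g zero + ι s⁻¹ * x
      eq = begin
        ι s⁻¹ * (x + ι s * g zero)             ≈⟨ L.distribˡ _ _ _ ⟩
        ι s⁻¹ * x + ι s⁻¹ * (ι s * g zero)     ≈⟨ L.+-congˡ (ι-inverse s≉0 (g zero)) ⟩
        ι s⁻¹ * x + g zero                     ≈⟨ L.+-comm _ _ ⟩
        g zero + ι s⁻¹ * x                     ∎

  -- Subfamilies indexed by a subset

  enum : ∀ {n} (Q : Subset n) → Fin ∣ Q ∣ → Fin n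
  enum (outside ∷ Q) i       = suc (enum Q i)
  enum (inside  ∷ Q) zero    = zero
  enum (inside  ∷ Q) (suc i) = suc (enum Q i)

  enum-∈ : ∀ {n} (Q : Subset n) i → enum Q i Subset.∈ Q
  enum-∈ (outside ∷ Q) i       = there (enum-∈ Q i)
  enum-∈ (inside  ∷ Q) zero    = here
  enum-∈ (inside  ∷ Q) (suc i) = there (enum-∈ Q i)

  enum-surjective : ∀ {n} (Q : Subset n) {j} → j Subset.∈ Q → ∃[ i ] enum Q i ≡ j
  enum-surjective (inside  ∷ Q) here = zero , ≡.refl
  enum-surjective (inside  ∷ Q) (there j∈Q) =
    let i , eq = enum-surjective Q j∈Q in suc i , ≡.cong suc eq
  enum-surjective (outside ∷ Q) (there j∈Q) =
    let i , eq = enum-surjective Q j∈Q in i , ≡.cong suc eq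

  -- Coefficients on `Q` are extended by zero to all indices; independence of the whole family
  -- thereby passes to the subfamily.
  enum-coefficients : ∀ {n} (Q : Subset n) (a : Vector K.Carrier ∣ Q ∣) v →
    ∃[ b ] (∀ i → b (enum Q i) ≡ a i) × linearCombination b v ≈ linearCombination a (v ∘ enum Q)
  enum-coefficients [] a v = (λ ()) , (λ ()) , L.refl
  enum-coefficients (outside ∷ Q) a v =
    let b , b≡a , eq = enum-coefficients Q a (v ∘ suc) in
    (λ { zero → K.0# ; (suc i) → b i }) , b≡a ,
    L.trans (L.+-cong (0·≈0 _ K.refl) eq) (L.+-identityˡ _)
  enum-coefficients (inside ∷ Q) a v =
    let b , b≡a , eq = enum-coefficients Q (a ∘ suc) (v ∘ suc) in
    (λ { zero → a zero ; (suc i) → b i }) , (λ { zero → ≡.refl ; (suc i) → b≡a i }) , L.+-congˡ eq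

  enum-independent : ∀ {n} (Q : Subset n) {v} → LinearlyIndependent v → LinearlyIndependent (v ∘ enum Q)
  enum-independent Q {v} ind a eq i =
    let b , b≡a , eq′ = enum-coefficients Q a v in
    K.trans (K.reflexive (≡.sym (b≡a i))) (ind b (L.trans eq′ eq) (enum Q i))

-- Exchanges for an arbitrary family of subspaces of B

module Matching {k ℓk c ℓ p q : Level} (em : ExcludedMiddle (k ⊔ ℓk ⊔ c ⊔ ℓ ⊔ p ⊔ q))
  (E : FieldExtension k ℓk c ℓ) where

  open FieldExtension E
  open LinearAlgebra E hiding (_∩_; T; _·_)
  open L using (_≈_; _+_; _*_; 0#)
  open Span E

  _≟0 : ∀ s → Dec (s K.≈ K.0#)
  s ≟0 = lowerEM ℓk (k ⊔ c ⊔ ℓ ⊔ p ⊔ q) em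

  module _ {n : ℕ} {B : Subspace p} (T : Fin n → Subspace q) (T⊆B : ∀ i → ⟦ T i ⟧ ⊆ ⟦ B ⟧) where

    Avoids : OrderedBasis B n → Pred (Fin n) _
    Avoids ℬ i = ⟦ T i ⟧ ⊆ ⟨ Others (vec ℬ) i ⟩

    -- The last clause makes vectors traceable through repeated exchanges: those in `T i` survive
    -- unchanged and merely swap labels.
    Exchanged : OrderedBasis B n → Fin n → Fin n → OrderedBasis B n → Set _
    Exchanged ℬ i h ℬ′ =
      i ∈ Avoids ℬ′ ×
      (∀ j → j ≢ i → j ≢ h → j ∈ Avoids ℬ → j ∈ Avoids ℬ′) ×
      (∀ j → vec ℬ j ∈ ⟦ T i ⟧ → vec ℬ′ (PC.transpose h i j) ≈ vec ℬ j)

    -- After the swap `x` carries the label `i`, and the scalars `s` push all other vectors into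
    -- `S`. Since `x ∉ S`, the part of `S` inside `B` is spanned by the vectors with labels other
    -- than `i`, and it contains `T i`.
    exchangeInto : ∀ (ℬ : OrderedBasis B n) i h (S : Subspace (k ⊔ q)) →
      let x = vec ℬ (PC.transpose i h i) in
      ⟦ T i ⟧ ⊆ ⟦ S ⟧ → x ∉ ⟦ S ⟧ →
      (s : Vector K.Carrier n) → (∀ j → vec ℬ (PC.transpose i h j) + ι (s j) * x ∈ ⟦ S ⟧) →
      ∃[ ℬ′ ] Exchanged ℬ i h ℬ′
    exchangeInto ℬ i h S T⊆S x∉S s g∈S = ℬ′ , avoids-i , avoids-j , fixed
      where
      π = transpose i h
      𝒢 = permuteBasis ℬ π
      x = vec 𝒢 i
      x∉T : x ∉ ⟦ T i ⟧
      x∉T x∈T = x∉S (T⊆S x∈T)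
      -- The scalar at `i` is reset to zero, so that the shear fixes `x` itself.
      b : Vector K.Carrier n
      b = updateAt s i (const K.0#)
      bᵢ≈0 : b i K.≈ K.0#
      bᵢ≈0 = K.reflexive (updateAt-updates i s)
      ℬ′ = shearBasis 𝒢 b i bᵢ≈0
      u = vec ℬ′

      u∈S : ∀ j → j ≢ i → u j ∈ ⟦ S ⟧
      u∈S j j≢i = ≡.subst (λ t → vec 𝒢 j + ι t * x ∈ ⟦ S ⟧) (≡.sym (updateAt-minimal j i s j≢i)) (g∈S j)

      uᵢ≈x : u i ≈ x
      uᵢ≈x = +-0·≈ x x bᵢ≈0

      uᵢ∉S : u i ∉ ⟦ S ⟧
      uᵢ∉S uᵢ∈S = x∉S (Subspace.respects S uᵢ≈x uᵢ∈S)

      avoids-i : i ∈ Avoids ℬ′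
      avoids-i t∈T = ∈-span-Others _≟0 ℬ′ i S u∈S uᵢ∉S (T⊆B i t∈T) (T⊆S t∈T)

      -- The shear only adds multiples of `x ≈ u i`, and `i ≢ j`, so the old vectors with labels
      -- other than `j` stay in the span of the new ones. Since `j` is neither `i` nor `h`, the swap
      -- leaves it in place.
      avoids-j : ∀ j → j ≢ i → j ≢ h → j ∈ Avoids ℬ → j ∈ Avoids ℬ′
      avoids-j j j≢i j≢h avoids t∈T = span-least (Others (vec ℬ) j) U
        (λ (l , l≢j , bₗ≈y) → Subspace.respects U bₗ≈y (old∈ l l≢j)) (avoids t∈T)
        where
        U = span (Others u j)
        old∈ : ∀ l → l ≢ j → vec ℬ l ∈ ⟦ U ⟧
        old∈ l l≢j = ≡.subst (λ m → vec ℬ m ∈ ⟦ U ⟧) (inverseʳ π)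
          (+-∈-cancelʳ U (⊆-span (Others u j) (π ⟨$⟩ˡ l , moved , L.refl))
            (Subspace.·-closed U _ (⊆-span (Others u j) (i , j≢i ∘ ≡.sym , uᵢ≈x))))
          where
          moved : π ⟨$⟩ˡ l ≢ j
          moved eq = l≢j (≡.trans (≡.sym (inverseʳ π))
            (≡.trans (≡.cong (π ⟨$⟩ʳ_) eq) (transpose-minimal i h j≢i j≢h)))

      fixed : ∀ j → vec ℬ j ∈ ⟦ T i ⟧ → u (PC.transpose h i j) ≈ vec ℬ j
      fixed j bⱼ∈T = L.trans (+-0·≈ _ x b≈0) (L.reflexive gₗ≡bⱼ)
        where
        l = PC.transpose h i j
        gₗ≡bⱼ : vec 𝒢 l ≡ vec ℬ j
        gₗ≡bⱼ = ≡.cong (vec ℬ) (inverseʳ π)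
        gₗ∈T : vec 𝒢 l ∈ ⟦ T i ⟧
        gₗ∈T = ≡.subst (_∈ ⟦ T i ⟧) (≡.sym gₗ≡bⱼ) bⱼ∈T
        l≢i : l ≢ i
        l≢i l≡i = x∉T (≡.subst (λ m → vec 𝒢 m ∈ ⟦ T i ⟧) l≡i gₗ∈T)
        -- A vector of `T i` is already in `S`, so the multiple of `x` added to it is in `S` too and
        -- must be zero.
        b≈0 : b l K.≈ K.0#
        b≈0 = scalar≈0 _≟0 S x∉S (+-∈-cancelʳ S
          (Subspace.respects S (L.+-comm _ _) (u∈S l l≢i)) (T⊆S gₗ∈T))

    exchange : ∀ (ℬ : OrderedBasis B n) i h → vec ℬ h ∉ ⟦ T i ⟧ → ∃[ ℬ′ ] Exchanged ℬ i h ℬ′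
    exchange ℬ i h h∉T =
      -- Adjoining `0#` does not change the elements of `T i`; it only raises the level to the
      -- `k ⊔ q` that `separate` works at.
      let S , T⊆S , x∉S , g∈S = separate _≟0 {q} (lowerEM (k ⊔ q) (ℓk ⊔ c ⊔ ℓ ⊔ p) em)
                                  (λ j → vec ℬ (PC.transpose i h j)) (adjoin (T i) 0#) x∉T+0
      in exchangeInto ℬ i h S (λ t∈T → T⊆S (⊆-adjoin (T i) 0# t∈T)) x∉S
           (λ j → proj₁ (g∈S j)) (λ j → proj₂ (g∈S j))
      where
      x = vec ℬ (PC.transpose i h i)
      x∉T+0 : x ∉ ⟦ adjoin (T i) 0# ⟧
      x∉T+0 (s , x+s0∈T) = h∉T (≡.subst (λ j → vec ℬ j ∈ ⟦ T i ⟧) (transpose[i,j,i]≡j i h)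
        (Subspace.respects (T i) (L.trans (L.+-congˡ (L.zeroʳ _)) (L.+-identityʳ x)) x+s0∈T))

    -- Maximal configurations and chains of exchanges

    -- The index is the number of matched labels, so maximality reads `¬ Config (ℕ.suc m)`.
    record Config (m : ℕ) : Set (k ⊔ ℓk ⊔ c ⊔ ℓ ⊔ p ⊔ q) where
      field
        basis  : OrderedBasis B n
        P      : Subset n
        size   : ∣ P ∣ ≡ m
        avoids : ∀ i → i Subset.∈ P → i ∈ Avoids basis

      b : Vector L.Carrier n
      b = vec basis

    open Config

    -- Here `i` enters the matched set and `h` leaves it. Only the consequences needed to trace
    -- vectors and missed labels are recorded.
    record Step {m} (C C′ : Config m) : Set (k ⊔ ℓk ⊔ c ⊔ ℓ ⊔ p ⊔ q) where
      field
        i      : Fin n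
        h      : Fin n
        i∉P    : i Subset.∉ P C
        h∉T    : b C h ∉ ⟦ T i ⟧
        h∉P′   : h Subset.∉ P C′
        others : ∀ j → j ≢ i → j Subset.∉ P C → j Subset.∉ P C′
        fixed  : ∀ j → b C j ∈ ⟦ T i ⟧ → b C′ (PC.transpose h i j) ≈ b C j

    -- The exchange can only spoil `h`, which was not matched anyway, so `i` is a pure gain; `h ≡ i`
    -- is allowed. Under maximality this forces `b C h` into `T i` for all `i` and `h` outside
    -- `P C`.
    augment : ∀ {m} (C : Config m) i h → i Subset.∉ P C → h Subset.∉ P C → b C h ∉ ⟦ T i ⟧ →
              Config (ℕ.suc m)
    augment C i h i∉P h∉P h∉T =
      let ℬ′ , avoids-i , avoids-j , _ = exchange (basis C) i h h∉T in record
      { basis  = ℬ′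
      ; P      = P C [ i ]≔ inside
      ; size   = ≡.trans (∣insert∣ i∉P) (≡.cong ℕ.suc (size C))
      ; avoids = λ j j∈P′ → case j ≟ i of λ
          { (yes ≡.refl) → avoids-i
          ; (no j≢i) → let j∈P = []≔-minimal⁻ (P C) j≢i j∈P′ in
              avoids-j j j≢i (λ { ≡.refl → h∉P j∈P }) (avoids C j j∈P) }
      }

    step : ∀ {m} (C : Config m) i h → i Subset.∉ P C → h Subset.∈ P C → b C h ∉ ⟦ T i ⟧ →
           ∃[ C′ ] Step C C′
    step C i h i∉P h∈P h∉T =
      let ℬ′ , avoids-i , avoids-j , fixed = exchange (basis C) i h h∉T in record
      { basis  = ℬ′
      ; P      = P₁ [ i ]≔ inside
      ; size   = ≡.trans (∣insert∣ (i∉P ∘ []≔-minimal⁻ (P C) i≢h)) (≡.trans (∣remove∣ h∈P) (size C))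
      ; avoids = λ j j∈P′ → case j ≟ i of λ
          { (yes ≡.refl) → avoids-i
          ; (no j≢i) → let j∈P₁ = []≔-minimal⁻ P₁ j≢i j∈P′
                           j≢h : j ≢ h
                           j≢h = λ { ≡.refl → h∉P₁ j∈P₁ } in
              avoids-j j j≢i j≢h (avoids C j ([]≔-minimal⁻ (P C) j≢h j∈P₁)) }
      } , record
      { i      = i
      ; h      = h
      ; i∉P    = i∉P
      ; h∉T    = h∉T
      ; h∉P′   = h∉P₁ ∘ []≔-minimal⁻ P₁ (i≢h ∘ ≡.sym)
      ; others = λ j j≢i j∉P j∈P′ → let j∈P₁ = []≔-minimal⁻ P₁ j≢i j∈P′ in
          j∉P ([]≔-minimal⁻ (P C) (λ { ≡.refl → h∉P₁ j∈P₁ }) j∈P₁)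
      ; fixed  = fixed
      }
      where
      P₁ = P C [ h ]≔ outside
      i≢h : i ≢ h
      i≢h ≡.refl = i∉P h∈P
      h∉P₁ : h Subset.∉ P₁
      h∉P₁ h∈P₁ with []=-injective h∈P₁ ([]≔-updates (P C) h)
      ... | ()

    module _ {m : ℕ} (maximal : ¬ Config (ℕ.suc m)) (C : Config m) where

      Missed : Pred (Fin n) _
      Missed j = ∃[ C′ ] Star Step C C′ × j Subset.∉ P C′

      J : Subset n
      J = proj₁ (comprehension Missed λ j → em)

      ∈J⁻ : ∀ {j} → j Subset.∈ J → j ∈ Missed
      ∈J⁻ {j} = proj₁ (proj₂ (comprehension Missed λ j → em) j)

      ∈J⁺ : ∀ {j} → j ∈ Missed → j Subset.∈ J
      ∈J⁺ {j} = proj₂ (proj₂ (comprehension Missed λ j → em) j)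

      -- These are the labels outside the intersection of `P C′` and `J`, split into the two cases
      -- that are treated differently.
      Free : Config m → Pred (Fin n) _
      Free C′ l = l Subset.∉ P C′ ⊎ l Subset.∉ J

      -- Suppose `b C′ l` were outside `T i`. If `l` is unmatched, `augment` contradicts maximality.
      -- If `l` is matched but outside `J`, a further step would make it missed, which puts it in
      -- `J`.
      free∈T : ∀ {C′} → Star Step C C′ → ∀ {i} → i Subset.∉ P C′ → ∀ {l} → l ∈ Free C′ → b C′ l ∈ ⟦ T i ⟧
      free∈T {C′} C⟶C′ {i} i∉P {l} (inj₁ l∉P) = decidable-stable (lowerEM q (k ⊔ ℓk ⊔ c ⊔ ℓ ⊔ p) em)
        λ l∉T → maximal (augment C′ i l i∉P l∉P l∉T)
      free∈T {C′} C⟶C′ {i} i∉P {l} (inj₂ l∉J) with l ∈? P C′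
      ... | no  l∉P = contradiction (∈J⁺ (C′ , C⟶C′ , l∉P)) l∉J
      ... | yes l∈P = decidable-stable (lowerEM q (k ⊔ ℓk ⊔ c ⊔ ℓ ⊔ p) em) λ l∉T →
        let C″ , st = step C′ i l i∉P l∈P l∉T in
        l∉J (∈J⁺ (C″ , C⟶C′ ◅◅ (st ◅ ε) , Step.h∉P′ st))

      -- A step only relabels the vectors b C′ l with l free.
      free-persists : ∀ {C₁ C₂} → Star Step C C₁ → Star Step C₁ C₂ → ∀ {l} → l ∈ Free C₁ →
                      ∃[ l′ ] l′ ∈ Free C₂ × b C₂ l′ ≈ b C₁ l
      free-persists reach ε {l} free = l , free , L.refl
      free-persists {C₁} reach (_◅_ {j = C₂} st rest) {l} free =
        let l′ , free′ , eq = free-persists (reach ◅◅ (st ◅ ε)) rest relabelled in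
        l′ , free′ , L.trans eq (Step.fixed st l l∈T)
        where
        open Step st
        l∈T : b C₁ l ∈ ⟦ T i ⟧
        l∈T = free∈T reach i∉P free
        l≢h : l ≢ h
        l≢h ≡.refl = h∉T l∈T
        relabelled : PC.transpose h i l ∈ Free C₂
        relabelled with l ≟ i
        ... | yes ≡.refl = inj₁ (≡.subst (Subset._∉ P C₂) (≡.sym (transpose[i,j,j]≡i h i)) h∉P′)
        ... | no  l≢i    = ≡.subst (_∈ Free C₂) (≡.sym (transpose-minimal h i l≢h l≢i))
          (⊎.map₁ (others l l≢i) free)

      -- Each `i` in `J` is missed by some reachable configuration. The vector reappears there under
      -- a free label, where `free∈T` places it in `T i`.
      free∈⋂ : ∀ {l} → l ∈ Free C → b C l ∈ ⟦ ⋂-in B J T ⟧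
      free∈⋂ {l} free = OrderedBasis.vec∈ (basis C) l , λ i i∈J →
        let C′ , reach , i∉P = ∈J⁻ i∈J
            l′ , free′ , eq = free-persists ε reach free in
        Subspace.respects (T i) eq (free∈T reach i∉P free′)

      ∁P⊆J : ∀ {i} → i Subset.∉ P C → i Subset.∈ J
      ∁P⊆J i∉P = ∈J⁺ (C , ε , i∉P)

    -- Dimension of the intersection

    -- For `i` both matched and in `J`, an element of the intersection lies in `T i`, hence in the
    -- span of the other vectors, and has no coordinate at `i`.
    ⋂⊆combinations : ∀ {m} (C : Config m) J → ⟦ ⋂-in B J T ⟧ ⊆ ⟦ combinations (b C) (Subset._∉ ∁ (P C Subset.∩ J)) ⟧
    ⋂⊆combinations C J {x} (x∈B , x∈T) =
      let a , _ , x≈ = coordinates (basis C) x∈B in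
      a , (λ i i∉ → let i∈P , i∈J = x∈p∩q⁻ (P C) J (x∉∁p⇒x∈p i∉) in
        coefficient≈0 (OrderedBasis.independent (basis C)) a i
          (Subspace.respects (span (Others (b C) i)) x≈ (avoids C i i∈P (x∈T i i∈J)))) , x≈

    ⋂-dimension≤ : ∀ {m d} (C : Config m) J → HasDimension (⋂-in B J T) d → d ≤ ∣ ∁ (P C Subset.∩ J) ∣
    ⋂-dimension≤ C J 𝒰 = steinitz _≟0 (∁ (P C Subset.∩ J)) (b C) (vec 𝒰) (OrderedBasis.independent 𝒰)
      λ i → ⋂⊆combinations C J (OrderedBasis.vec∈ 𝒰 i)

    -- The basis vectors with free labels lie in the intersection by `free∈⋂` and span it by
    -- `⋂⊆combinations`. The inclusion in `J` is returned too, for the final count.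
    ⋂-dimension : ∀ {m} → ¬ Config (ℕ.suc m) → (C : Config m) →
      ∃[ J ] (∀ {i} → i Subset.∉ P C → i Subset.∈ J) × HasDimension (⋂-in B J T) ∣ ∁ (P C Subset.∩ J) ∣
    ⋂-dimension maximal C = J′ , ∁P⊆J maximal C , record
      { vec         = b C ∘ enum Q
      ; vec∈        = λ i → free∈⋂ maximal C (free (enum-∈ Q i))
      ; independent = enum-independent Q (OrderedBasis.independent (basis C))
      ; spanning    = λ x∈ →
          let a , a≈0 , x≈ = ⋂⊆combinations C J′ x∈ in
          Subspace.respects (span X) (L.sym x≈) (lc-∈-span X λ i → case i ∈? Q of λ
            { (yes i∈Q) → let j , eq = enum-surjective Q i∈Q in inj₂ (j , L.reflexive (≡.cong (b C) eq))
            ; (no  i∉Q) → inj₁ (a≈0 i i∉Q) })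
      }
      where
      J′ = J maximal C
      Q = ∁ (P C Subset.∩ J′)
      X = Range (b C ∘ enum Q)
      free : ∀ {l} → l Subset.∈ Q → l ∈ Free maximal C C
      free {l} l∈Q with l ∈? P C
      ... | no  l∉P = inj₁ l∉P
      ... | yes l∈P = inj₂ λ l∈J → x∈∁p⇒x∉p l∈Q (x∈p∩q⁺ (l∈P , l∈J))

-- Defects, Ω and the deficiency

module Deficiency {k ℓk c ℓ p : Level} (em : ExcludedMiddle (k ⊔ ℓk ⊔ c ⊔ ℓ ⊔ p))
  (E : FieldExtension k ℓk c ℓ) where

  open LinearAlgebra E
  open Matching {p = p} {q = c ⊔ ℓ ⊔ p} em E

  module _ {n : ℕ} {A B : Subspace p} (ℬ₀ : HasDimension B n) where

    module _ (𝒜 : OrderedBasis A n) where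

      Matched : Pred ℕ _
      Matched e = ∃[ ℬ ] BasisPartiallyMatched {B = B} 𝒜 ℬ e

      matched-n : Matched n
      matched-n = ℬ₀ , ℕ.≤-refl , Subset.⊥ , ≡.trans (∣⊥∣≡0 n) (≡.sym (ℕ.n∸n≡0 n)) ,
                  λ i i∈⊥ → contradiction i∈⊥ ∉⊥

      matched-mono : ∀ {d e} → d ≤ e → e ≤ n → Matched d → Matched e
      matched-mono d≤e e≤n (ℬ , _ , P , ∣P∣≡ , avoids) =
        let Q , Q⊆P , ∣Q∣≡ = shrink P (ℕ.≤-trans (ℕ.∸-monoʳ-≤ n d≤e) (ℕ.≤-reflexive (≡.sym ∣P∣≡))) in
        ℬ , e≤n , Q , ∣Q∣≡ , λ i i∈Q → avoids i (Q⊆P i∈Q)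

      T⊆B : ∀ i → ⟦ T 𝒜 B i ⟧ ⊆ ⟦ B ⟧
      T⊆B i = proj₂

      toConfig : ∀ {e} → Matched e → Config {B = B} (T 𝒜 B) T⊆B (n ∸ e)
      toConfig (ℬ , _ , P , ∣P∣≡ , avoids) = record { basis = ℬ ; P = P ; size = ∣P∣≡ ; avoids = avoids }

      module _ {m : ℕ} (C : Config {B = B} (T 𝒜 B) T⊆B m) where
        open Config C

        m≤n : m ≤ n
        m≤n = ≡.subst (_≤ n) size (∣p∣≤n P)

        fromConfig : Matched (n ∸ m)
        fromConfig = basis , ℕ.m∸n≤m n m , P , ≡.trans size (≡.sym (ℕ.m∸[m∸n]≡n m≤n)) , avoids

      -- One matching bounds the candidates for all J. Adding `∣ P ∣` to both sides keeps truncated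
      -- subtraction out of the count.
      ΩCandidate≤matched : ∀ {z e} → z ∈ ΩCandidate 𝒜 B → Matched e → z ℤ.≤ + e
      ΩCandidate≤matched {e = e} (J , d , ⋂-dim , ≡.refl) matched@(_ , e≤n , _) = x-n≤e e n
        (ℕ.+-cancelʳ-≤ (∣ P ∣) (∣ J ∣ ℕ.+ d) (e ℕ.+ n) (begin
          ∣ J ∣ ℕ.+ d ℕ.+ ∣ P ∣
            ≤⟨ ℕ.+-monoˡ-≤ (∣ P ∣) (ℕ.+-monoʳ-≤ (∣ J ∣) (⋂-dimension≤ (T 𝒜 B) T⊆B C J ⋂-dim)) ⟩
          ∣ J ∣ ℕ.+ ∣ ∁ (P Subset.∩ J) ∣ ℕ.+ ∣ P ∣
            ≡⟨ ∣q∣+∣∁[p∩q]∣+∣p∣≡∣p∪q∣+n P J ⟩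
          ∣ P Subset.∪ J ∣ ℕ.+ n
            ≤⟨ ℕ.+-monoˡ-≤ n (∣p∣≤n (P Subset.∪ J)) ⟩
          n ℕ.+ n
            ≡⟨ e+n+∣p∣≡n+n P e≤n size ⟨
          e ℕ.+ n ℕ.+ ∣ P ∣ ∎))
        where
        open ℕ.≤-Reasoning
        C = toConfig matched
        open Config C

      leastMatched : ∃[ d ] IsLeast Matched d
      leastMatched = least (λ _ → em) matched-n

      least⇒ΩCandidate : ∀ {d} → IsLeast Matched d → + d ∈ ΩCandidate 𝒜 B
      least⇒ΩCandidate {d} (matched@(_ , d≤n , _) , d≤) =
        let J , ∁P⊆J , ⋂-dim = ⋂-dimension (T 𝒜 B) T⊆B maximal C in
        J , ∣ ∁ (P Subset.∩ J) ∣ , ⋂-dim , ≡.sym (≡.trans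
          (≡.cong (λ x → + x ℤ.- + n) (ℕ.+-cancelʳ-≡ (∣ P ∣) _ _ (begin
            ∣ J ∣ ℕ.+ ∣ ∁ (P Subset.∩ J) ∣ ℕ.+ ∣ P ∣  ≡⟨ ∣q∣+∣∁[p∩q]∣+∣p∣≡∣p∪q∣+n P J ⟩
            ∣ P Subset.∪ J ∣ ℕ.+ n                    ≡⟨ ≡.cong (ℕ._+ n) (∣p∪q∣≡n P J ∁P⊆J) ⟩
            n ℕ.+ n                                   ≡⟨ e+n+∣p∣≡n+n P d≤n size ⟨
            d ℕ.+ n ℕ.+ ∣ P ∣                         ∎)))
          ([e+n]-n≡e d n))
        where
        open ≡.≡-Reasoning
        C = toConfig matched
        open Config C
        -- One more matched label would give a defect below `d`. The subtraction is strict because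
        -- `m≤n` keeps it from being truncated.
        maximal : ¬ Config {B = B} (T 𝒜 B) T⊆B (ℕ.suc (n ∸ d))
        maximal C′ = ℕ.≤⇒≯ (d≤ _ (fromConfig C′))
          (ℕ.<-≤-trans (ℕ.∸-monoʳ-< ℕ.≤-refl (m≤n C′)) (ℕ.≤-reflexive (ℕ.m∸[m∸n]≡n d≤n)))

      Ω-leastMatched : ∃[ d ] IsΩ 𝒜 B (+ d) × IsLeast Matched d
      Ω-leastMatched =
        let d , d-least = leastMatched in
        d , (least⇒ΩCandidate d-least , λ z z∈Ω → ΩCandidate≤matched z∈Ω (proj₁ d-least)) , d-least

    -- The deficiency is a possible defect for every `𝒜`, so it bounds each Ω. If no `𝒜` attained
    -- it, all least defects would be at most δ - 1, and by `matched-mono` that defect would serve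
    -- every `𝒜`.
    deficiency-maxΩ : HasDimension A n →
      ∃[ δ ] IsDeficiency A B n δ × IsMaximum (λ z → ∃[ 𝒜 ] IsΩ {A = A} {n = n} 𝒜 B z) (+ δ)
    deficiency-maxΩ 𝒜₀ =
      δ , δ-least , decidable-stable em attained ,
      λ z (𝒜 , z∈Ω , _) → ΩCandidate≤matched 𝒜 z∈Ω (proj₁ δ-least 𝒜)
      where
      deficiency : ∃[ δ ] IsDeficiency A B n δ
      deficiency = least (λ _ → em) matched-n
      δ = proj₁ deficiency
      δ-least = proj₂ deficiency

      attained : ¬ ¬ (∃[ 𝒜 ] IsΩ {A = A} {n = n} 𝒜 B (+ δ))
      attained none = ℕ.<-irrefl ≡.refl (begin-strict
        ℕ.pred δ  <⟨ δ-1<δ ⟩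
        δ         ≤⟨ proj₂ δ-least (ℕ.pred δ) (λ 𝒜 →
                       matched-mono 𝒜 (ℕ.<⇒≤pred (Ω<δ 𝒜)) (ℕ.≤-trans ℕ.pred[n]≤n δ≤n) (proj₁ (proj₂ (leastMatched 𝒜)))) ⟩
        ℕ.pred δ  ∎)
        where
        open ℕ.≤-Reasoning
        δ≤n : δ ≤ n
        δ≤n = proj₂ δ-least n matched-n
        Ω<δ : ∀ 𝒜 → proj₁ (leastMatched 𝒜) < δ
        Ω<δ 𝒜 =
          let d , d-Ω , d-least = Ω-leastMatched 𝒜 in
          ℕ.≤∧≢⇒< (proj₂ d-least δ (proj₁ δ-least 𝒜)) λ d≡δ →
            none (𝒜 , ≡.subst (λ x → IsΩ {A = A} {n = n} 𝒜 B (+ x)) d≡δ d-Ω)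
        -- As `ℕ.pred 0` is `0`, strictness requires δ to be positive; the given basis `𝒜₀` shows
        -- this through `Ω<δ`.
        δ-1<δ : ℕ.pred δ < δ
        δ-1<δ = ℕ.≤-reflexive (ℕ.suc-pred δ ⦃ ℕ.>-nonZero (ℕ.≤-<-trans z≤n (Ω<δ 𝒜₀)) ⦄)

theorem3p11 :
    ∀ {k ℓk c ℓ p : Level} → ExcludedMiddle (k ⊔ ℓk ⊔ c ⊔ ℓ ⊔ p) →
    (E : FieldExtension k ℓk c ℓ) → FieldExtension.IsProper E →
    let open FieldExtension E
        open LinearAlgebra E
    in
    (n : ℕ) → 0 < n → (A B : Subspace p) →
    HasDimension A n → HasDimension B n → L.1# ∉ ⟦ B ⟧ →
    ((𝒜 : OrderedBasis A n) →
      ∃[ d ] IsΩ 𝒜 B (+ d) ×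
             IsLeast (λ e → ∃[ ℬ ] BasisPartiallyMatched {B = B} 𝒜 ℬ e) d)
    ×
    (∃[ δ ] IsDeficiency A B n δ ×
            IsMaximum (λ z → ∃[ 𝒜 ] IsΩ {A = A} {n = n} 𝒜 B z) (+ δ))
theorem3p11 em E _ n _ A B 𝒜₀ ℬ₀ _ = Ω-leastMatched {A = A} ℬ₀ , deficiency-maxΩ ℬ₀ 𝒜₀
  where open Deficiency em E
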